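{- The following is provable in $\mathrm{HA}^\omega$ together with the defining equation of $\mathsf{eps}$. Let $q\colon\Pi_iX_i\to R$, $\ell\colon R\to\mathbb{N}$ and $\varepsilon\colon\Pi_iJ_RX_i$ be given. Define $$\alpha = \mathsf{eps}^\ell_0(\varepsilon)(q),\qquad p_n(x)=\overline{\mathsf{eps}^\ell_{n+1}(\varepsilon)}(q_{[\alpha](n)*x})\quad (x\colon X_n).$$ Then for all $n\le \ell(q(\alpha))$ we have $$\alpha(n)=\varepsilon_n(p_n)\ \text{ (in } X_n),\qquad p_n(\alpha(n))=q(\alpha)\ \text{ (in } R).$$
   Context: Types and systems. Finite types are generated from $\mathbb{B}$ (booleans) and $\mathbb{N}$ by $X\times Y$, $X\to Y$ and $X^*$ (finite sequences). For a sequence of types $(X_i)_{i\in\mathbb{N}}$, $\Pi_i X_i$ is the type of infinite sequences whose $i$-th entry is in $X_i$ and $\Pi_{i<n}X_i$ the type of finite sequences of length $n$. (This is used for readability; one may take all $X_i$ equal to one type $X$, reading $\Pi_iX_i$ as $\mathbb{N}\to X$ and finite sequence types as $X^*$.) $\mathrm{HA}^\omega$ is Heyting arithmetic in all finite types with fully extensional equality (Troelstra's E-$\mathrm{HA}^\omega$). $\mathbf{0}$ denotes the canonical zero object of each type (the zero sequence for sequence types). Notation. $*$ is concatenation. For a finite sequence $s$ and functional $q$ on infinite sequences, $q_s(\beta)=q(s*\beta)$ (and $q_x=q_{\langle x\rangle}$). $[\alpha](n)=\langle\alpha(0),\dots,\alpha(n-1)\rangle$. $J_RX=(X\to R)\to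 X$; for a selection function $\delta\colon J_RX$, $\overline{\delta}(p)=p(\delta(p))$. $\mathsf{eps}$. For $\varepsilon\colon\Pi_kJ_RX_k$, $\ell\colon R\to\mathbb{N}$, $q\colon\Pi_iX_{i+n}\to R$, the value $\mathsf{eps}^\ell_n(\varepsilon)(q)\colon\Pi_iX_{i+n}$ is specified by: $\mathsf{eps}^\ell_n(\varepsilon)(q)=\mathbf{0}$ if $\ell(q(\mathbf{0}))<n$, and otherwise $\mathsf{eps}^\ell_n(\varepsilon)(q)=c*\mathsf{eps}^\ell_{n+1}(\varepsilon)(q_c)$, where $c=\varepsilon_n(\lambda x.\,\overline{\mathsf{eps}^\ell_{n+1}(\varepsilon)}(q_x))$. -}

module Defs where

open import Data.List using (List; []; _∷_; map)
open import Data.List.Membership.Propositional using (_∈_)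
open import Data.List.Relation.Binary.Subset.Propositional using (_⊆_)
open import Data.List.Relation.Unary.Any using (here; there)
open import Function using (id; _∘_)
open import Relation.Binary.PropositionalEquality using (refl)

infixr 6 _⇒_
infixr 7 _⊗_
infix  8 _*

data Ty : Set where
  bool nat : Ty
  _⊗_ _⇒_  : Ty → Ty → Ty
  _*       : Ty → Ty

-- Infinite sequences.  The entries all have the same type X, so that
-- Π_i X_i is nat ⇒ X and every Π_{i<n} X_i is contained in X *.

_ω : Ty → Ty
X ω = nat ⇒ X

J : Ty → Ty → Ty
J R X = (X ⇒ R) ⇒ X

variable
  σ τ ρ X R : Ty

Ctx : Set
Ctx = List Ty

variable
  Γ Θ : Ctx

-- Finite sequences are generated by nil and by snoc, which adds an entry
-- at the right-hand end.  The language has the eps constants from the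
-- outset; nothing is assumed about them in HA^ω itself.

data Const : Ty → Set where
  ttᶜ ffᶜ  : Const bool
  ifᶜ      : ∀ σ → Const (σ ⇒ σ ⇒ bool ⇒ σ)
  zeroᶜ    : Const nat
  sucᶜ     : Const (nat ⇒ nat)
  recᶜ     : ∀ σ → Const (σ ⇒ (nat ⇒ σ ⇒ σ) ⇒ nat ⇒ σ)
  pairᶜ    : ∀ σ τ → Const (σ ⇒ τ ⇒ σ ⊗ τ)
  fstᶜ     : ∀ σ τ → Const (σ ⊗ τ ⇒ σ)
  sndᶜ     : ∀ σ τ → Const (σ ⊗ τ ⇒ τ)
  nilᶜ     : ∀ σ → Const (σ *)
  snocᶜ    : ∀ σ → Const (σ * ⇒ σ ⇒ σ *)
  foldᶜ    : ∀ σ τ → Const (τ ⇒ (σ * ⇒ σ ⇒ τ ⇒ τ) ⇒ σ * ⇒ τ)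
  epsᶜ     : ∀ X R → Const ((R ⇒ nat) ⇒ nat ⇒ (nat ⇒ J R X) ⇒ J R (X ω))

infixl 9 _·_

data Tm (Γ : Ctx) : Ty → Set where
  var : σ ∈ Γ → Tm Γ σ
  con : Const σ → Tm Γ σ
  lam : Tm (σ ∷ Γ) τ → Tm Γ (σ ⇒ τ)
  _·_ : Tm Γ (σ ⇒ τ) → Tm Γ σ → Tm Γ τ

lift : Γ ⊆ Θ → (σ ∷ Γ) ⊆ (σ ∷ Θ)
lift r (here e)  = here e
lift r (there x) = there (r x)

ren : Γ ⊆ Θ → Tm Γ σ → Tm Θ σ
ren r (var x) = var (r x)
ren r (con c) = con c
ren r (lam t) = lam (ren (lift r) t)
ren r (t · u) = ren r t · ren r u

wk : Tm Γ σ → Tm (τ ∷ Γ) σ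
wk = ren there

Sub : Ctx → Ctx → Set
Sub Γ Θ = ∀ {σ} → σ ∈ Γ → Tm Θ σ

lifts : Sub Γ Θ → Sub (σ ∷ Γ) (σ ∷ Θ)
lifts s (here e)  = var (here e)
lifts s (there x) = wk (s x)

sub : Sub Γ Θ → Tm Γ σ → Tm Θ σ
sub s (var x) = s x
sub s (con c) = con c
sub s (lam t) = lam (sub (lifts s) t)
sub s (t · u) = sub s t · sub s u

-- t ▹ r sends the most recent variable to t and renames the others by r.

infix 5 _▹_

_▹_ : Tm Θ σ → Γ ⊆ Θ → Sub (σ ∷ Γ) Θ
(t ▹ r) (here refl) = t
(t ▹ r) (there x)   = var (r x)

infix 10 _[_]

_[_] : Tm (σ ∷ Γ) τ → Tm Γ σ → Tm Γ τ
t [ u ] = sub (u ▹ id) t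

-- Equality is primitive at every type; extensionality is a rule below.

infix  5 _≐_
infixr 4 _∧̇_
infixr 3 _∨̇_
infixr 2 _⇒̇_

data Fm (Γ : Ctx) : Set where
  _≐_            : Tm Γ σ → Tm Γ σ → Fm Γ
  ⊥̇              : Fm Γ
  _∧̇_ _∨̇_ _⇒̇_   : Fm Γ → Fm Γ → Fm Γ
  ∀̇ ∃̇            : (σ : Ty) → Fm (σ ∷ Γ) → Fm Γ

¬̇_ : Fm Γ → Fm Γ
¬̇ φ = φ ⇒̇ ⊥̇

renF : Γ ⊆ Θ → Fm Γ → Fm Θ
renF r (t ≐ u) = ren r t ≐ ren r u
renF r ⊥̇       = ⊥̇
renF r (φ ∧̇ ψ) = renF r φ ∧̇ renF r ψ
renF r (φ ∨̇ ψ) = renF r φ ∨̇ renF r ψ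
renF r (φ ⇒̇ ψ) = renF r φ ⇒̇ renF r ψ
renF r (∀̇ σ φ) = ∀̇ σ (renF (lift r) φ)
renF r (∃̇ σ φ) = ∃̇ σ (renF (lift r) φ)

wkF : Fm Γ → Fm (τ ∷ Γ)
wkF = renF there

subF : Sub Γ Θ → Fm Γ → Fm Θ
subF s (t ≐ u) = sub s t ≐ sub s u
subF s ⊥̇       = ⊥̇
subF s (φ ∧̇ ψ) = subF s φ ∧̇ subF s ψ
subF s (φ ∨̇ ψ) = subF s φ ∨̇ subF s ψ
subF s (φ ⇒̇ ψ) = subF s φ ⇒̇ subF s ψ
subF s (∀̇ σ φ) = ∀̇ σ (subF (lifts s) φ)
subF s (∃̇ σ φ) = ∃̇ σ (subF (lifts s) φ)

infix 10 _⟦_⟧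

_⟦_⟧ : Fm (σ ∷ Γ) → Tm Γ σ → Fm Γ
φ ⟦ t ⟧ = subF (t ▹ id) φ

v0 : Tm (σ ∷ Γ) σ
v0 = var (here refl)

v1 : Tm (τ ∷ σ ∷ Γ) σ
v1 = wk v0

v2 : Tm (ρ ∷ τ ∷ σ ∷ Γ) σ
v2 = wk v1

v3 : Tm (X ∷ ρ ∷ τ ∷ σ ∷ Γ) σ
v3 = wk v2

zeroᵗ : Tm Γ nat
zeroᵗ = con zeroᶜ

sucᵗ : Tm Γ nat → Tm Γ nat
sucᵗ n = con sucᶜ · n

nil : Tm Γ (X *)
nil = con (nilᶜ _)

snoc : Tm Γ (X *) → Tm Γ X → Tm Γ (X *)
snoc s x = con (snocᶜ _) · s · x

⟨_⟩ : Tm Γ X → Tm Γ (X *)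
⟨ x ⟩ = snoc nil x

𝟎 : ∀ σ → Tm Γ σ
𝟎 bool    = con ffᶜ
𝟎 nat     = zeroᵗ
𝟎 (σ ⊗ τ) = con (pairᶜ σ τ) · 𝟎 σ · 𝟎 τ
𝟎 (σ ⇒ τ) = lam (𝟎 τ)
𝟎 (σ *)   = nil

-- Operations are written as closed terms applied to their arguments, so
-- that they commute definitionally with renaming and substitution.

infixl 8 _+̇_

_+̇_ : Tm Γ nat → Tm Γ nat → Tm Γ nat
m +̇ n = con (recᶜ nat) · m · lam (lam (sucᵗ v0)) · n

-- The infinite sequence x , β(0) , β(1) , …

consω : Tm Γ X → Tm Γ (X ω) → Tm Γ (X ω)
consω x β =
  lam (lam (lam (con (recᶜ _) · v2 · lam (lam (v3 · v1)) · v0))) · x · β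

-- Concatenation s ⊛ β of a finite and an infinite sequence, by recursion
-- on s:  nil ⊛ β = β  and  snoc s x ⊛ β = s ⊛ consω x β.

infixr 8 _⊛_

_⊛_ : Tm Γ (X *) → Tm Γ (X ω) → Tm Γ (X ω)
s ⊛ β =
  con (foldᶜ _ _) · lam v0 · lam (lam (lam (lam (v1 · consω v2 v0)))) · s · β

-- The finite sequence ⟨α(0), …, α(n-1)⟩.

initial : Tm Γ (X ω) → Tm Γ nat → Tm Γ (X *)
initial α n =
  lam (lam (con (recᶜ _) · nil · lam (lam (snoc v0 (v3 · v1))) · v0)) · α · n

-- q_s(β) = q(s ⊛ β)

shift : Tm Γ (X ω ⇒ R) → Tm Γ (X *) → Tm Γ (X ω ⇒ R)
shift q s = lam (lam (lam (v2 · (v1 ⊛ v0)))) · q · s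

-- The functional p ↦ p(δ(p)).

overline : Tm Γ (J R X) → Tm Γ ((X ⇒ R) ⇒ R)
overline δ = lam (lam (v0 · (v1 · v0))) · δ

-- eps^ℓ_n(ε)

eps : Tm Γ (R ⇒ nat) → Tm Γ nat → Tm Γ (nat ⇒ J R X) → Tm Γ (J R (X ω))
eps ℓ n ε = con (epsᶜ _ _) · ℓ · n · ε

infix 5 _≤̇_ _<̇_

_≤̇_ : Tm Γ nat → Tm Γ nat → Fm Γ
m ≤̇ n = ∃̇ nat (wk m +̇ v0 ≐ wk n)

_<̇_ : Tm Γ nat → Tm Γ nat → Fm Γ
m <̇ n = sucᵗ m ≤̇ n

-- E-HA^ω in natural deduction style.  HAω[ Ax ] Δ ⊢ φ  says that φ is derivable from the
-- assumptions Δ when the sentences in Ax are added as axioms; the free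
-- variables of Δ and φ are those of the context Γ.

infix 1 HAω[_]_⊢_

data HAω[_]_⊢_ (Ax : Fm [] → Set) {Γ : Ctx} (Δ : List (Fm Γ)) : Fm Γ → Set where

  axiom : ∀ {φ} → Ax φ → HAω[ Ax ] Δ ⊢ renF (λ ()) φ
  hyp   : ∀ {φ} → φ ∈ Δ → HAω[ Ax ] Δ ⊢ φ

  ⊥E  : ∀ {φ} → HAω[ Ax ] Δ ⊢ ⊥̇ → HAω[ Ax ] Δ ⊢ φ
  ∧I  : ∀ {φ ψ} → HAω[ Ax ] Δ ⊢ φ → HAω[ Ax ] Δ ⊢ ψ → HAω[ Ax ] Δ ⊢ φ ∧̇ ψ
  ∧E₁ : ∀ {φ ψ} → HAω[ Ax ] Δ ⊢ φ ∧̇ ψ → HAω[ Ax ] Δ ⊢ φ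
  ∧E₂ : ∀ {φ ψ} → HAω[ Ax ] Δ ⊢ φ ∧̇ ψ → HAω[ Ax ] Δ ⊢ ψ
  ∨I₁ : ∀ {φ ψ} → HAω[ Ax ] Δ ⊢ φ → HAω[ Ax ] Δ ⊢ φ ∨̇ ψ
  ∨I₂ : ∀ {φ ψ} → HAω[ Ax ] Δ ⊢ ψ → HAω[ Ax ] Δ ⊢ φ ∨̇ ψ
  ∨E  : ∀ {φ ψ χ} → HAω[ Ax ] Δ ⊢ φ ∨̇ ψ →
        HAω[ Ax ] (φ ∷ Δ) ⊢ χ → HAω[ Ax ] (ψ ∷ Δ) ⊢ χ → HAω[ Ax ] Δ ⊢ χ
  ⇒I  : ∀ {φ ψ} → HAω[ Ax ] (φ ∷ Δ) ⊢ ψ → HAω[ Ax ] Δ ⊢ φ ⇒̇ ψ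
  ⇒E  : ∀ {φ ψ} → HAω[ Ax ] Δ ⊢ φ ⇒̇ ψ → HAω[ Ax ] Δ ⊢ φ → HAω[ Ax ] Δ ⊢ ψ
  ∀I  : ∀ {φ} → HAω[ Ax ] (map wkF Δ) ⊢ φ → HAω[ Ax ] Δ ⊢ ∀̇ σ φ
  ∀E  : ∀ {φ} → HAω[ Ax ] Δ ⊢ ∀̇ σ φ → (t : Tm Γ σ) → HAω[ Ax ] Δ ⊢ φ ⟦ t ⟧
  ∃I  : ∀ {φ} (t : Tm Γ σ) → HAω[ Ax ] Δ ⊢ φ ⟦ t ⟧ → HAω[ Ax ] Δ ⊢ ∃̇ σ φ
  ∃E  : ∀ {φ ψ} → HAω[ Ax ] Δ ⊢ ∃̇ σ φ →
        HAω[ Ax ] (φ ∷ map wkF Δ) ⊢ wkF ψ → HAω[ Ax ] Δ ⊢ ψ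

  ≐-refl  : (t : Tm Γ σ) → HAω[ Ax ] Δ ⊢ t ≐ t
  ≐-subst : {t u : Tm Γ σ} (φ : Fm (σ ∷ Γ)) →
            HAω[ Ax ] Δ ⊢ t ≐ u → HAω[ Ax ] Δ ⊢ φ ⟦ t ⟧ → HAω[ Ax ] Δ ⊢ φ ⟦ u ⟧
  ≐-ext   : {f g : Tm Γ (σ ⇒ τ)} →
            HAω[ Ax ] Δ ⊢ ∀̇ σ (wk f · v0 ≐ wk g · v0) → HAω[ Ax ] Δ ⊢ f ≐ g

  β-lam : (t : Tm (σ ∷ Γ) τ) (u : Tm Γ σ) → HAω[ Ax ] Δ ⊢ lam t · u ≐ t [ u ]

  β-tt  : (t u : Tm Γ σ) → HAω[ Ax ] Δ ⊢ con (ifᶜ σ) · t · u · con ttᶜ ≐ t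
  β-ff  : (t u : Tm Γ σ) → HAω[ Ax ] Δ ⊢ con (ifᶜ σ) · t · u · con ffᶜ ≐ u

  β-zero : (t : Tm Γ σ) (u : Tm Γ (nat ⇒ σ ⇒ σ)) →
           HAω[ Ax ] Δ ⊢ con (recᶜ σ) · t · u · zeroᵗ ≐ t
  β-suc  : (t : Tm Γ σ) (u : Tm Γ (nat ⇒ σ ⇒ σ)) (n : Tm Γ nat) →
           HAω[ Ax ] Δ ⊢ con (recᶜ σ) · t · u · sucᵗ n
                           ≐ u · n · (con (recᶜ σ) · t · u · n)

  β-fst : (t : Tm Γ σ) (u : Tm Γ τ) →
          HAω[ Ax ] Δ ⊢ con (fstᶜ σ τ) · (con (pairᶜ σ τ) · t · u) ≐ t
  β-snd : (t : Tm Γ σ) (u : Tm Γ τ) →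
          HAω[ Ax ] Δ ⊢ con (sndᶜ σ τ) · (con (pairᶜ σ τ) · t · u) ≐ u
  η-⊗   : (t : Tm Γ (σ ⊗ τ)) →
          HAω[ Ax ] Δ ⊢
            con (pairᶜ σ τ) · (con (fstᶜ σ τ) · t) · (con (sndᶜ σ τ) · t) ≐ t

  β-nil  : (t : Tm Γ τ) (u : Tm Γ (σ * ⇒ σ ⇒ τ ⇒ τ)) →
           HAω[ Ax ] Δ ⊢ con (foldᶜ σ τ) · t · u · nil ≐ t
  β-snoc : (t : Tm Γ τ) (u : Tm Γ (σ * ⇒ σ ⇒ τ ⇒ τ))
           (s : Tm Γ (σ *)) (x : Tm Γ σ) →
           HAω[ Ax ] Δ ⊢ con (foldᶜ σ τ) · t · u · snoc s x
                           ≐ u · s · x · (con (foldᶜ σ τ) · t · u · s)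

  suc≢zero : (n : Tm Γ nat) → HAω[ Ax ] Δ ⊢ ¬̇ (sucᵗ n ≐ zeroᵗ)
  suc-inj  : (m n : Tm Γ nat) → HAω[ Ax ] Δ ⊢ sucᵗ m ≐ sucᵗ n ⇒̇ m ≐ n

  ind-bool : (φ : Fm (bool ∷ Γ)) →
             HAω[ Ax ] Δ ⊢ φ ⟦ con ttᶜ ⟧ → HAω[ Ax ] Δ ⊢ φ ⟦ con ffᶜ ⟧ →
             HAω[ Ax ] Δ ⊢ ∀̇ bool φ
  ind-nat  : (φ : Fm (nat ∷ Γ)) →
             HAω[ Ax ] Δ ⊢ φ ⟦ zeroᵗ ⟧ →
             HAω[ Ax ] Δ ⊢ ∀̇ nat (φ ⇒̇ subF (sucᵗ v0 ▹ there) φ) →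
             HAω[ Ax ] Δ ⊢ ∀̇ nat φ
  ind-seq  : (φ : Fm (σ * ∷ Γ)) →
             HAω[ Ax ] Δ ⊢ φ ⟦ nil ⟧ →
             HAω[ Ax ] Δ ⊢ ∀̇ (σ *) (∀̇ σ
               (subF (v1 ▹ there ∘ there) φ ⇒̇
                subF (snoc v1 v0 ▹ there ∘ there) φ)) →
             HAω[ Ax ] Δ ⊢ ∀̇ (σ *) φ

eps-equation : (X R : Ty) → Fm []
eps-equation X R =
  ∀̇ (R ⇒ nat) (∀̇ nat (∀̇ (nat ⇒ J R X) (∀̇ (X ω ⇒ R)
    (let ℓ = v3
         n = v2
         ε = v1
         q = v0
         c = ε · n · lam (overline (eps (wk ℓ) (sucᵗ (wk n)) (wk ε))
                            · shift (wk q) ⟨ v0 ⟩)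
     in
       (ℓ · (q · 𝟎 (X ω)) <̇ n
          ⇒̇ eps ℓ n ε · q ≐ 𝟎 (X ω))
     ∧̇ (¬̇ (ℓ · (q · 𝟎 (X ω)) <̇ n)
          ⇒̇ eps ℓ n ε · q ≐ ⟨ c ⟩ ⊛ (eps ℓ (sucᵗ n) ε · shift q ⟨ c ⟩))))))

data EpsAxiom : Fm [] → Set where
  eps-eq : ∀ X R → EpsAxiom (eps-equation X R)

infix 1 HAω+eps⊢_

HAω+eps⊢_ : Fm [] → Set
HAω+eps⊢ φ = HAω[ EpsAxiom ] [] ⊢ φ

{-# OPTIONS --safe #-}

-- Write s = [α](n).  By induction on n, inside HA^ω,
--   α = s * eps_n(q_s).
-- If ℓ(q_s(𝟎)) < n, then α = s * 𝟎, so α(n) = 𝟎 and q_s and q_{[α](n+1)}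
-- agree at 𝟎, whence eps_{n+1}(q_{[α](n+1)}) = 𝟎 as well.  Otherwise the
-- equation of eps gives α = s * c * eps_{n+1}(q_{s*c}) with
-- c = ε_n(p_n), so α(n) = c.  In the first case ℓ(q(α)) = ℓ(q_s(𝟎)) < n, so
-- n ≤ ℓ(q(α)) forces the second, and α(n) = ε_n(p_n).  The invariant at
-- n + 1 says q(α) = p_n(α(n)).

module Submission where

open import Defs
open import Data.List using (List; []; _∷_; _++_; map)
open import Data.List.Membership.Propositional using (_∈_)
open import Data.List.Relation.Binary.Subset.Propositional using (_⊆_)
open import Data.List.Relation.Unary.All using (All; []; _∷_)
open import Data.List.Relation.Unary.Any using (here; there)
open import Function using (id)
open import Relation.Binary.PropositionalEquality
  using (_≡_; refl; sym; trans; cong; cong₂; subst; subst₂)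

private variable
  Ξ : Ctx
  Ax : Fm [] → Set
  Δ : List (Fm Γ)

-- Renaming and substitution

lifts-cong : {s s′ : Sub Γ Θ} → (∀ {σ} (x : σ ∈ Γ) → s x ≡ s′ x) →
             (x : τ ∈ (σ ∷ Γ)) → lifts s x ≡ lifts s′ x
lifts-cong e (here _)  = refl
lifts-cong e (there x) = cong wk (e x)

lifts-var : {s : Sub Γ Γ} → (∀ {σ} (x : σ ∈ Γ) → s x ≡ var x) →
            (x : τ ∈ (σ ∷ Γ)) → lifts s x ≡ var x
lifts-var e (here _)  = refl
lifts-var e (there x) = cong wk (e x)

sub-cong : {s s′ : Sub Γ Θ} → (∀ {σ} (x : σ ∈ Γ) → s x ≡ s′ x) →
           (t : Tm Γ τ) → sub s t ≡ sub s′ t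
sub-cong e (var x) = e x
sub-cong e (con c) = refl
sub-cong e (lam t) = cong lam (sub-cong (lifts-cong e) t)
sub-cong e (t · u) = cong₂ _·_ (sub-cong e t) (sub-cong e u)

sub-var : {s : Sub Γ Γ} → (∀ {σ} (x : σ ∈ Γ) → s x ≡ var x) →
          (t : Tm Γ τ) → sub s t ≡ t
sub-var e (var x) = e x
sub-var e (con c) = refl
sub-var e (lam t) = cong lam (sub-var (lifts-var e) t)
sub-var e (t · u) = cong₂ _·_ (sub-var e t) (sub-var e u)

ren-as-sub : (r : Γ ⊆ Θ) (t : Tm Γ τ) → ren r t ≡ sub (λ x → var (r x)) t
ren-as-sub r (var x) = refl
ren-as-sub r (con c) = refl
ren-as-sub r (lam t) = cong lam (trans (ren-as-sub (lift r) t) (sub-cong e t))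
  where
  e : ∀ {σ} (x : σ ∈ _) → var (lift r x) ≡ lifts (λ y → var (r y)) x
  e (here _)  = refl
  e (there x) = refl
ren-as-sub r (t · u) = cong₂ _·_ (ren-as-sub r t) (ren-as-sub r u)

sub-ren : (s : Sub Θ Ξ) (r : Γ ⊆ Θ) (t : Tm Γ τ) →
          sub s (ren r t) ≡ sub (λ x → s (r x)) t
sub-ren s r (var x) = refl
sub-ren s r (con c) = refl
sub-ren s r (lam t) =
  cong lam (trans (sub-ren (lifts s) (lift r) t) (sub-cong e t))
  where
  e : ∀ {σ} (x : σ ∈ _) → lifts s (lift r x) ≡ lifts (λ y → s (r y)) x
  e (here _)  = refl
  e (there x) = refl
sub-ren s r (t · u) = cong₂ _·_ (sub-ren s r t) (sub-ren s r u)

ren-lift-wk : (r : Γ ⊆ Θ) (t : Tm Γ τ) →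
              ren (lift {σ = σ} r) (wk t) ≡ wk (ren r t)
ren-lift-wk r t =
  trans (ren-as-sub (lift r) (wk t))
  (trans (sub-ren _ there t)
  (sym (trans (ren-as-sub there (ren r t)) (sub-ren _ r t))))

ren-sub : (r : Θ ⊆ Ξ) (s : Sub Γ Θ) (t : Tm Γ τ) →
          ren r (sub s t) ≡ sub (λ x → ren r (s x)) t
ren-sub r s (var x) = refl
ren-sub r s (con c) = refl
ren-sub r s (lam t) =
  cong lam (trans (ren-sub (lift r) (lifts s) t) (sub-cong e t))
  where
  e : ∀ {σ} (x : σ ∈ _) →
      ren (lift r) (lifts s x) ≡ lifts (λ y → ren r (s y)) x
  e (here _)  = refl
  e (there x) = ren-lift-wk r (s x)
ren-sub r s (t · u) = cong₂ _·_ (ren-sub r s t) (ren-sub r s u)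

sub-lifts-lifts : (s′ : Sub Θ Ξ) (s : Sub Γ Θ) (x : τ ∈ (σ ∷ Γ)) →
                  sub (lifts s′) (lifts s x) ≡ lifts (λ y → sub s′ (s y)) x
sub-lifts-lifts s′ s (here _)  = refl
sub-lifts-lifts s′ s (there x) =
  trans (sub-ren (lifts s′) there (s x)) (sym (ren-sub there s′ (s x)))

sub-sub : (s′ : Sub Θ Ξ) (s : Sub Γ Θ) (t : Tm Γ τ) →
          sub s′ (sub s t) ≡ sub (λ x → sub s′ (s x)) t
sub-sub s′ s (var x) = refl
sub-sub s′ s (con c) = refl
sub-sub s′ s (lam t) =
  cong lam (trans (sub-sub (lifts s′) (lifts s) t)
                  (sub-cong (sub-lifts-lifts s′ s) t))
sub-sub s′ s (t · u) = cong₂ _·_ (sub-sub s′ s t) (sub-sub s′ s u)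

subF-cong : {s s′ : Sub Γ Θ} → (∀ {σ} (x : σ ∈ Γ) → s x ≡ s′ x) →
            (φ : Fm Γ) → subF s φ ≡ subF s′ φ
subF-cong e (t ≐ u) = cong₂ _≐_ (sub-cong e t) (sub-cong e u)
subF-cong e ⊥̇       = refl
subF-cong e (φ ∧̇ ψ) = cong₂ _∧̇_ (subF-cong e φ) (subF-cong e ψ)
subF-cong e (φ ∨̇ ψ) = cong₂ _∨̇_ (subF-cong e φ) (subF-cong e ψ)
subF-cong e (φ ⇒̇ ψ) = cong₂ _⇒̇_ (subF-cong e φ) (subF-cong e ψ)
subF-cong e (∀̇ σ φ) = cong (∀̇ σ) (subF-cong (lifts-cong e) φ)
subF-cong e (∃̇ σ φ) = cong (∃̇ σ) (subF-cong (lifts-cong e) φ)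

subF-id : {s : Sub Γ Γ} → (∀ {σ} (x : σ ∈ Γ) → s x ≡ var x) →
          (φ : Fm Γ) → subF s φ ≡ φ
subF-id e (t ≐ u) = cong₂ _≐_ (sub-var e t) (sub-var e u)
subF-id e ⊥̇       = refl
subF-id e (φ ∧̇ ψ) = cong₂ _∧̇_ (subF-id e φ) (subF-id e ψ)
subF-id e (φ ∨̇ ψ) = cong₂ _∨̇_ (subF-id e φ) (subF-id e ψ)
subF-id e (φ ⇒̇ ψ) = cong₂ _⇒̇_ (subF-id e φ) (subF-id e ψ)
subF-id e (∀̇ σ φ) = cong (∀̇ σ) (subF-id (lifts-var e) φ)
subF-id e (∃̇ σ φ) = cong (∃̇ σ) (subF-id (lifts-var e) φ)

subF-subF : (s′ : Sub Θ Ξ) (s : Sub Γ Θ) (φ : Fm Γ) →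
            subF s′ (subF s φ) ≡ subF (λ x → sub s′ (s x)) φ
subF-subF s′ s (t ≐ u) = cong₂ _≐_ (sub-sub s′ s t) (sub-sub s′ s u)
subF-subF s′ s ⊥̇       = refl
subF-subF s′ s (φ ∧̇ ψ) = cong₂ _∧̇_ (subF-subF s′ s φ) (subF-subF s′ s ψ)
subF-subF s′ s (φ ∨̇ ψ) = cong₂ _∨̇_ (subF-subF s′ s φ) (subF-subF s′ s ψ)
subF-subF s′ s (φ ⇒̇ ψ) = cong₂ _⇒̇_ (subF-subF s′ s φ) (subF-subF s′ s ψ)
subF-subF s′ s (∀̇ σ φ) =
  cong (∀̇ σ) (trans (subF-subF (lifts s′) (lifts s) φ)
                    (subF-cong (sub-lifts-lifts s′ s) φ))
subF-subF s′ s (∃̇ σ φ) =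
  cong (∃̇ σ) (trans (subF-subF (lifts s′) (lifts s) φ)
                    (subF-cong (sub-lifts-lifts s′ s) φ))

wk-[] : (t : Tm Γ τ) (u : Tm Γ σ) → wk t [ u ] ≡ t
wk-[] t u = trans (sub-ren (u ▹ id) there t) (sub-var (λ _ → refl) t)

-- `𝟎` recurses on the type, so at an unknown type it does not reduce, and its stability under
-- renaming has to be proved by induction.
ren-𝟎 : (r : Γ ⊆ Θ) (σ : Ty) → ren r (𝟎 σ) ≡ 𝟎 σ
ren-𝟎 r bool    = refl
ren-𝟎 r nat     = refl
ren-𝟎 r (σ ⊗ τ) = cong₂ (λ t u → con (pairᶜ σ τ) · t · u) (ren-𝟎 r σ) (ren-𝟎 r τ)
ren-𝟎 r (σ ⇒ τ) = cong lam (ren-𝟎 (lift r) τ)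
ren-𝟎 r (σ *)   = refl

sub-𝟎 : (s : Sub Γ Θ) (σ : Ty) → sub s (𝟎 σ) ≡ 𝟎 σ
sub-𝟎 s bool    = refl
sub-𝟎 s nat     = refl
sub-𝟎 s (σ ⊗ τ) = cong₂ (λ t u → con (pairᶜ σ τ) · t · u) (sub-𝟎 s σ) (sub-𝟎 s τ)
sub-𝟎 s (σ ⇒ τ) = cong lam (sub-𝟎 (lifts s) τ)
sub-𝟎 s (σ *)   = refl

-- The head of `Θ` becomes the innermost quantifier, so terms passed to `instantiate` are listed
-- with the one for `v0` first.
∀⋆ : (Θ : Ctx) → Fm (Θ ++ Γ) → Fm Γ
∀⋆ []      φ = φ
∀⋆ (σ ∷ Θ) φ = ∀⋆ Θ (∀̇ σ φ)

parallel : All (Tm Γ) Θ → Sub (Θ ++ Γ) Γ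
parallel []       x           = var x
parallel (t ∷ ts) (here refl) = t
parallel (t ∷ ts) (there x)   = parallel ts x

parallel-∷ : (t : Tm Γ σ) (ts : All (Tm Γ) Θ) (x : τ ∈ (σ ∷ Θ ++ Γ)) →
             sub (t ▹ id) (lifts (parallel ts) x) ≡ parallel (t ∷ ts) x
parallel-∷ t ts (here refl) = refl
parallel-∷ t ts (there x)   = wk-[] (parallel ts x) t

-- On a concrete φ the substitution parallel ts computes, so that instances
-- of closed theorems at arbitrary terms hold on the nose.
instantiate : {φ : Fm (Θ ++ Γ)} → HAω[ Ax ] Δ ⊢ ∀⋆ Θ φ →
              (ts : All (Tm Γ) Θ) → HAω[ Ax ] Δ ⊢ subF (parallel ts) φ
instantiate {φ = φ} d [] = subst (HAω[ _ ] _ ⊢_) (sym (subF-id (λ _ → refl) φ)) d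
instantiate {φ = φ} d (t ∷ ts) =
  subst (HAω[ _ ] _ ⊢_)
        (trans (subF-subF (t ▹ id) (lifts (parallel ts)) φ)
               (subF-cong (parallel-∷ t ts) φ))
        (∀E (instantiate {φ = ∀̇ _ φ} d ts) t)

-- Equality

≐-sym : {t u : Tm Γ σ} → HAω[ Ax ] Δ ⊢ t ≐ u → HAω[ Ax ] Δ ⊢ u ≐ t
≐-sym {t = t} {u} d =
  subst (λ t′ → HAω[ _ ] _ ⊢ u ≐ t′) (wk-[] t u)
    (≐-subst (v0 ≐ wk t) d
      (subst (λ t′ → HAω[ _ ] _ ⊢ t ≐ t′) (sym (wk-[] t t)) (≐-refl t)))

≐-trans : {t u v : Tm Γ σ} →
          HAω[ Ax ] Δ ⊢ t ≐ u → HAω[ Ax ] Δ ⊢ u ≐ v → HAω[ Ax ] Δ ⊢ t ≐ v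
≐-trans {t = t} {u} {v} d e =
  subst (λ t′ → HAω[ _ ] _ ⊢ t′ ≐ v) (wk-[] t v)
    (≐-subst (wk t ≐ v0) e
      (subst (λ t′ → HAω[ _ ] _ ⊢ t′ ≐ u) (sym (wk-[] t u)) d))

sub-≐ : (C : Tm (σ ∷ Γ) τ) {t u : Tm Γ σ} →
        HAω[ Ax ] Δ ⊢ t ≐ u → HAω[ Ax ] Δ ⊢ C [ t ] ≐ C [ u ]
sub-≐ C {t} {u} d =
  subst (λ c → HAω[ _ ] _ ⊢ c ≐ C [ u ]) (wk-[] (C [ t ]) u)
    (≐-subst (wk (C [ t ]) ≐ C) d
      (subst (λ c → HAω[ _ ] _ ⊢ c ≐ C [ t ]) (sym (wk-[] (C [ t ]) t))
        (≐-refl (C [ t ]))))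

infixl 9 _⟨·⟩_

_⟨·⟩_ : {f g : Tm Γ (σ ⇒ τ)} {t u : Tm Γ σ} →
        HAω[ Ax ] Δ ⊢ f ≐ g → HAω[ Ax ] Δ ⊢ t ≐ u → HAω[ Ax ] Δ ⊢ f · t ≐ g · u
_⟨·⟩_ {f = f} {g} {t} {u} d e =
  ≐-trans
    (subst (λ a → HAω[ _ ] _ ⊢ f · a ≐ g · a) (wk-[] t g)
      (subst (λ a → HAω[ _ ] _ ⊢ f · a ≐ g · wk t [ g ])
        (trans (wk-[] t f) (sym (wk-[] t g))) (sub-≐ (v0 · wk t) d)))
    (subst (λ h → HAω[ _ ] _ ⊢ h · t ≐ g · u) (wk-[] g t)
      (subst (λ h → HAω[ _ ] _ ⊢ wk g [ t ] · t ≐ h · u)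
        (wk-[] g u) (sub-≐ (wk g · v0) e)))

infix  3 _∎
infixr 2 _≐⟨_⟩_ _≐⟨_⟨_

_≐⟨_⟩_ : (t : Tm Γ σ) {u v : Tm Γ σ} →
         HAω[ Ax ] Δ ⊢ t ≐ u → HAω[ Ax ] Δ ⊢ u ≐ v → HAω[ Ax ] Δ ⊢ t ≐ v
t ≐⟨ d ⟩ e = ≐-trans d e

_≐⟨_⟨_ : (t : Tm Γ σ) {u v : Tm Γ σ} →
         HAω[ Ax ] Δ ⊢ u ≐ t → HAω[ Ax ] Δ ⊢ u ≐ v → HAω[ Ax ] Δ ⊢ t ≐ v
t ≐⟨ d ⟨ e = ≐-trans (≐-sym d) e

_∎ : (t : Tm Γ σ) → HAω[ Ax ] Δ ⊢ t ≐ t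
t ∎ = ≐-refl t

ap : (f : Tm Γ (σ ⇒ τ)) {t u : Tm Γ σ} →
     HAω[ Ax ] Δ ⊢ t ≐ u → HAω[ Ax ] Δ ⊢ f · t ≐ f · u
ap f d = ≐-refl f ⟨·⟩ d

-- Extensionality reduces the claim to a fresh argument, where both sides contract by β. This
-- permits rewriting inside the abstraction that defines p_n.
ξ : {t u : Tm (σ ∷ Γ) τ} →
    HAω[ Ax ] map wkF Δ ⊢ t ≐ u → HAω[ Ax ] Δ ⊢ lam t ≐ lam u
ξ {t = t} {u} d = ≐-ext (∀I (≐-trans (β t) (≐-trans d (≐-sym (β u)))))
  where
  β : (t : Tm (_ ∷ _) _) → HAω[ _ ] _ ⊢ wk (lam t) · v0 ≐ t
  β t = subst (λ t′ → HAω[ _ ] _ ⊢ wk (lam t) · v0 ≐ t′)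
          (trans (sub-ren (v0 ▹ id) (lift there) t)
                 (sub-var (λ { (here refl) → refl ; (there _) → refl }) t))
          (β-lam (ren (lift there) t) v0)

β₁ : (t : Tm (σ ∷ Γ) τ) (a : Tm Γ σ) →
     HAω[ Ax ] Δ ⊢ lam t · a ≐ sub (parallel (a ∷ [])) t
β₁ t a = subst (λ t′ → HAω[ _ ] _ ⊢ lam t · a ≐ t′)
           (sub-cong (λ { (here refl) → refl ; (there _) → refl }) t) (β-lam t a)

-- Contracting a term that already carries `parallel ts` composes to one substitution with one more
-- entry. Hence `β₂`, `β₃` and `β₄` end in substitutions that compute on concrete bodies.
β-step : (ts : All (Tm Γ) Θ) (t : Tm (σ ∷ Θ ++ Γ) τ) (a : Tm Γ σ) →
         HAω[ Ax ] Δ ⊢ sub (parallel ts) (lam t) · a ≐ sub (parallel (a ∷ ts)) t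
β-step ts t a =
  subst (λ t′ → HAω[ _ ] _ ⊢ sub (parallel ts) (lam t) · a ≐ t′)
    (trans (sub-sub (a ▹ id) (lifts (parallel ts)) t)
           (sub-cong (parallel-∷ a ts) t))
    (β-lam (sub (lifts (parallel ts)) t) a)

β₂ : (t : Tm (σ ∷ τ ∷ Γ) ρ) (a : Tm Γ τ) (b : Tm Γ σ) →
     HAω[ Ax ] Δ ⊢ lam (lam t) · a · b ≐ sub (parallel (b ∷ a ∷ [])) t
β₂ t a b = ≐-trans (β₁ (lam t) a ⟨·⟩ ≐-refl b) (β-step (a ∷ []) t b)

β₃ : (t : Tm (σ ∷ τ ∷ ρ ∷ Γ) X) (a : Tm Γ ρ) (b : Tm Γ τ) (c : Tm Γ σ) →
     HAω[ Ax ] Δ ⊢ lam (lam (lam t)) · a · b · c ≐ sub (parallel (c ∷ b ∷ a ∷ [])) t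
β₃ t a b c = ≐-trans (β₂ (lam t) a b ⟨·⟩ ≐-refl c) (β-step (b ∷ a ∷ []) t c)

β₄ : (t : Tm (σ ∷ τ ∷ ρ ∷ R ∷ Γ) X)
     (a : Tm Γ R) (b : Tm Γ ρ) (c : Tm Γ τ) (d : Tm Γ σ) →
     HAω[ Ax ] Δ ⊢ lam (lam (lam (lam t))) · a · b · c · d
                     ≐ sub (parallel (d ∷ c ∷ b ∷ a ∷ [])) t
β₄ t a b c d = ≐-trans (β₃ (lam t) a b c ⟨·⟩ ≐-refl d) (β-step (c ∷ b ∷ a ∷ []) t d)

-- Arithmetic

+-zero : (m : Tm Γ nat) → HAω[ Ax ] Δ ⊢ m +̇ zeroᵗ ≐ m
+-zero m = β-zero m _

+-suc : (m n : Tm Γ nat) → HAω[ Ax ] Δ ⊢ m +̇ sucᵗ n ≐ sucᵗ (m +̇ n)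
+-suc m n = ≐-trans (β-suc m _ n) (β₂ (sucᵗ v0) n (m +̇ n))

+-congˡ : {l m n : Tm Γ nat} →
          HAω[ Ax ] Δ ⊢ l ≐ m → HAω[ Ax ] Δ ⊢ l +̇ n ≐ m +̇ n
+-congˡ d = ≐-refl _ ⟨·⟩ d ⟨·⟩ ≐-refl _ ⟨·⟩ ≐-refl _

zero-+ : (n : Tm Γ nat) → HAω[ Ax ] Δ ⊢ zeroᵗ +̇ n ≐ n
zero-+ = ∀E (ind-nat (zeroᵗ +̇ v0 ≐ v0)
  (+-zero zeroᵗ)
  (∀I (⇒I (≐-trans (+-suc zeroᵗ v0) (ap (con sucᶜ) (hyp (here refl)))))))

-- The induction is carried out on variables, where substitutions compute; `instantiate` then
-- carries the result to arbitrary terms. Several later lemmas follow this pattern.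
suc-+ : (m n : Tm Γ nat) → HAω[ Ax ] Δ ⊢ sucᵗ m +̇ n ≐ sucᵗ (m +̇ n)
suc-+ m n = instantiate {Θ = nat ∷ nat ∷ []} {φ = sucᵗ v1 +̇ v0 ≐ sucᵗ (v1 +̇ v0)}
  (∀I (ind-nat (sucᵗ v1 +̇ v0 ≐ sucᵗ (v1 +̇ v0))
    (≐-trans (+-zero _) (ap (con sucᶜ) (≐-sym (+-zero _))))
    (∀I (⇒I (≐-trans (+-suc _ _) (ap (con sucᶜ)
      (≐-trans (hyp (here refl)) (≐-sym (+-suc _ _)))))))))
  (n ∷ m ∷ [])

+-assoc : (l m n : Tm Γ nat) → HAω[ Ax ] Δ ⊢ (l +̇ m) +̇ n ≐ l +̇ (m +̇ n)
+-assoc l m n = instantiate {Θ = nat ∷ nat ∷ nat ∷ []} {φ = (v2 +̇ v1) +̇ v0 ≐ v2 +̇ (v1 +̇ v0)}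
  (∀I (∀I (ind-nat ((v2 +̇ v1) +̇ v0 ≐ v2 +̇ (v1 +̇ v0))
    (≐-trans (+-zero _) (ap _ (≐-sym (+-zero _))))
    (∀I (⇒I
      ((v2 +̇ v1) +̇ sucᵗ v0    ≐⟨ +-suc _ _ ⟩
       sucᵗ ((v2 +̇ v1) +̇ v0)  ≐⟨ ap _ (hyp (here refl)) ⟩
       sucᵗ (v2 +̇ (v1 +̇ v0))  ≐⟨ +-suc _ _ ⟨
       v2 +̇ sucᵗ (v1 +̇ v0)    ≐⟨ ap _ (+-suc _ _) ⟨
       v2 +̇ (v1 +̇ sucᵗ v0)    ∎))))))
  (n ∷ m ∷ l ∷ [])

n≢suc[n+k] : (n k : Tm Γ nat) → HAω[ Ax ] Δ ⊢ ¬̇ (n ≐ sucᵗ (n +̇ k))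
n≢suc[n+k] n k = instantiate {Θ = nat ∷ nat ∷ []} {φ = ¬̇ (v0 ≐ sucᵗ (v0 +̇ v1))}
  (∀I (ind-nat (¬̇ (v0 ≐ sucᵗ (v0 +̇ v1)))
    (⇒I (⇒E (suc≢zero _) (≐-sym (hyp (here refl)))))
    (∀I (⇒I (⇒I (⇒E (hyp (there (here refl)))
      (≐-trans (⇒E (suc-inj _ _) (hyp (here refl))) (suc-+ _ _))))))))
  (n ∷ k ∷ [])

-- From `n +̇ a ≐ m` and `sucᵗ m +̇ b ≐ n` follows `m ≐ sucᵗ (m +̇ (b +̇ a))`, which `n≢suc[n+k]`
-- excludes. This supplies the negated premise of the second clause for `eps`.
≤⇒≯ : (m n : Tm Γ nat) → HAω[ Ax ] Δ ⊢ n ≤̇ m ⇒̇ ¬̇ (m <̇ n)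
≤⇒≯ m n =
  instantiate {Θ = nat ∷ nat ∷ []} {φ = v1 ≤̇ v0 ⇒̇ ¬̇ (v0 <̇ v1)}
    (∀I (∀I (⇒I (⇒I (∃E (hyp (here refl)) (∃E (hyp (there (there (here refl))))
      (⇒E (n≢suc[n+k] v2 (v1 +̇ v0))
        (v2                       ≐⟨ hyp (here refl) ⟨
         v3 +̇ v0                  ≐⟨ +-congˡ (hyp (there (here refl))) ⟨
         (sucᵗ v2 +̇ v1) +̇ v0      ≐⟨ +-assoc _ _ _ ⟩
         sucᵗ v2 +̇ (v1 +̇ v0)      ≐⟨ suc-+ _ _ ⟩
         sucᵗ (v2 +̇ (v1 +̇ v0))    ∎))))))))
    (m ∷ n ∷ [])

<-suc : (m n : Tm Γ nat) → HAω[ Ax ] Δ ⊢ m <̇ n ⇒̇ m <̇ sucᵗ n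
<-suc m n = instantiate {Θ = nat ∷ nat ∷ []} {φ = v0 <̇ v1 ⇒̇ v0 <̇ sucᵗ v1}
  (∀I (∀I (⇒I (∃E (hyp (here refl)) (∃I (sucᵗ v0)
    (≐-trans (+-suc _ _) (ap _ (hyp (here refl)))))))))
  (m ∷ n ∷ [])

<-resp-≐ : (l m n : Tm Γ nat) → HAω[ Ax ] Δ ⊢ l ≐ m ⇒̇ l <̇ n ⇒̇ m <̇ n
<-resp-≐ l m n =
  instantiate {Θ = nat ∷ nat ∷ nat ∷ []} {φ = v0 ≐ v1 ⇒̇ v0 <̇ v2 ⇒̇ v1 <̇ v2}
    (∀I (∀I (∀I (⇒I (⇒I
      (≐-subst (v0 <̇ wk v2) (hyp (there (here refl))) (hyp (here refl))))))))
    (l ∷ m ∷ n ∷ [])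

-- The logic is intuitionistic, so the case split on the stopping condition has to be derived, here
-- by induction on `n`.
<-or-≥ : (m n : Tm Γ nat) → HAω[ Ax ] Δ ⊢ m <̇ n ∨̇ n ≤̇ m
<-or-≥ m n = instantiate {Θ = nat ∷ nat ∷ []} {φ = v1 <̇ v0 ∨̇ v0 ≤̇ v1}
  (∀I (ind-nat (v1 <̇ v0 ∨̇ v0 ≤̇ v1)
    (∨I₂ (∃I v0 (zero-+ v0)))
    (∀I (⇒I (∨E (hyp (here refl))
      (∨I₁ (⇒E (<-suc v1 v0) (hyp (here refl))))
      (∃E (hyp (here refl)) (⇒E
        -- Case distinction on the witness k of `n +̇ k ≐ m`: zero gives `m ≐ n`, hence
        -- `m <̇ sucᵗ n`, and a successor gives `sucᵗ n ≤̇ m`.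
        (∀E (ind-nat (v2 +̇ v0 ≐ v3 ⇒̇ v3 <̇ sucᵗ v2 ∨̇ sucᵗ v2 ≤̇ v3)
          (⇒I (∨I₁ (∃I zeroᵗ (≐-trans (+-zero _)
            (ap _ (≐-trans (≐-sym (hyp (here refl))) (+-zero _)))))))
          (∀I (⇒I (⇒I (∨I₂ (∃I v0
            (≐-trans (suc-+ _ _) (≐-trans (≐-sym (+-suc _ _)) (hyp (here refl)))))))))) v0)
        (hyp (here refl)))))))))
  (n ∷ m ∷ [])

-- Sequences

consω-zero : (x : Tm Γ X) (β : Tm Γ (X ω)) → HAω[ Ax ] Δ ⊢ consω x β · zeroᵗ ≐ x
consω-zero x β = ≐-trans (β₃ _ x β zeroᵗ) (β-zero _ _)

wk²-parallel : (t : Tm Γ τ) (a : Tm Γ σ) (b : Tm Γ ρ) →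
               sub (parallel (a ∷ b ∷ [])) (wk (wk t)) ≡ t
wk²-parallel t a b =
  trans (sub-ren _ there (wk t)) (trans (sub-ren _ there t) (sub-var (λ _ → refl) t))

consω-suc : (x : Tm Γ X) (β : Tm Γ (X ω)) (n : Tm Γ nat) →
            HAω[ Ax ] Δ ⊢ consω x β · sucᵗ n ≐ β · n
consω-suc x β n =
  ≐-trans (β₃ _ x β (sucᵗ n)) (≐-trans (β-suc _ _ n)
    (subst (λ t → HAω[ _ ] _ ⊢ lam (lam (wk (wk β) · v1)) · n · r ≐ t · n)
      (wk²-parallel β r n) (β₂ (wk (wk β) · v1) n r)))
  where
  r = con (recᶜ _) · x · lam (lam (wk (wk β) · v1)) · n

-- By extensionality and a split on the index. The general form lets the proof run on variables;
-- `consω-𝟎` is the instance at the zero sequence.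
consω-const : (x : Tm Γ X) (β : Tm Γ (X ω)) →
              HAω[ Ax ] Δ ⊢ ∀̇ nat (wk β · v0 ≐ wk x) ⇒̇ consω x β ≐ β
consω-const {X = X} x β =
  instantiate {Θ = X ∷ X ω ∷ []} {φ = ∀̇ nat (v2 · v0 ≐ v1) ⇒̇ consω v0 v1 ≐ v1}
    (∀I (∀I (⇒I (≐-ext (ind-nat _
      (≐-trans (consω-zero _ _) (≐-sym (∀E (hyp (here refl)) zeroᵗ)))
      (∀I (⇒I (≐-trans (consω-suc _ _ _)
        (≐-trans (∀E (hyp (there (here refl))) v0)
          (≐-sym (∀E (hyp (there (here refl))) (sucᵗ v0))))))))))))
    (x ∷ β ∷ [])

𝟎ω-· : (n : Tm Γ nat) → HAω[ Ax ] Δ ⊢ 𝟎 (X ω) · n ≐ 𝟎 X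
𝟎ω-· {X = X} n = subst (λ t → HAω[ _ ] _ ⊢ 𝟎 (X ω) · n ≐ t) (sub-𝟎 _ X) (β-lam (𝟎 X) n)

consω-𝟎 : (X : Ty) → HAω[ Ax ] Δ ⊢ consω (𝟎 X) (𝟎 (X ω)) ≐ 𝟎 (X ω)
consω-𝟎 {Ax = Ax} {Δ = Δ} X = ⇒E (consω-const (𝟎 X) (𝟎 (X ω)))
  (∀I (subst₂ (λ t u → HAω[ Ax ] map wkF Δ ⊢ t · v0 ≐ u)
    (sym (ren-𝟎 there (X ω))) (sym (ren-𝟎 there X)) (𝟎ω-· v0)))

nil-⊛ : (β : Tm Γ (X ω)) → HAω[ Ax ] Δ ⊢ nil ⊛ β ≐ β
nil-⊛ β = ≐-trans (β-nil _ _ ⟨·⟩ ≐-refl β) (β₁ v0 β)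

snoc-⊛ : (s : Tm Γ (X *)) (x : Tm Γ X) (β : Tm Γ (X ω)) →
         HAω[ Ax ] Δ ⊢ snoc s x ⊛ β ≐ s ⊛ consω x β
snoc-⊛ s x β = ≐-trans (β-snoc _ _ s x ⟨·⟩ ≐-refl β) (β₄ _ s x _ β)

⊛-cong : {s t : Tm Γ (X *)} {β γ : Tm Γ (X ω)} →
         HAω[ Ax ] Δ ⊢ s ≐ t → HAω[ Ax ] Δ ⊢ β ≐ γ → HAω[ Ax ] Δ ⊢ s ⊛ β ≐ t ⊛ γ
⊛-cong d e = ≐-refl _ ⟨·⟩ d ⟨·⟩ e

⟨⟩-⊛ : (x : Tm Γ X) (β : Tm Γ (X ω)) → HAω[ Ax ] Δ ⊢ ⟨ x ⟩ ⊛ β ≐ consω x β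
⟨⟩-⊛ x β = ≐-trans (snoc-⊛ nil x β) (nil-⊛ _)

initial-zero : (α : Tm Γ (X ω)) → HAω[ Ax ] Δ ⊢ initial α zeroᵗ ≐ nil
initial-zero α = ≐-trans (β₂ _ α zeroᵗ) (β-zero _ _)

initial-suc : (α : Tm Γ (X ω)) (n : Tm Γ nat) →
              HAω[ Ax ] Δ ⊢ initial α (sucᵗ n) ≐ snoc (initial α n) (α · n)
initial-suc α n =
  initial α (sucᵗ n)                             ≐⟨ β₂ _ α (sucᵗ n) ⟩
  con (recᶜ _) · nil · step · sucᵗ n             ≐⟨ β-suc nil step n ⟩
  step · n · r                                   ≐⟨ β₂ (snoc v0 (wk (wk α) · v1)) n r ⟩
  snoc r (sub (parallel (r ∷ n ∷ [])) (wk (wk α)) · n)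
    ≐⟨ subst (λ t → HAω[ _ ] _ ⊢ snoc r (t · n) ≐ snoc (initial α n) (α · n))
         (sym (wk²-parallel α r n))
         (ap _ (≐-sym (β₂ _ α n)) ⟨·⟩ ≐-refl _) ⟩
  snoc (initial α n) (α · n)                     ∎
  where
  step = lam (lam (snoc v0 (wk (wk α) · v1)))
  r = con (recᶜ _) · nil · step · n

shift-· : (q : Tm Γ (X ω ⇒ R)) (s : Tm Γ (X *)) (β : Tm Γ (X ω)) →
          HAω[ Ax ] Δ ⊢ shift q s · β ≐ q · (s ⊛ β)
shift-· q s β = β₃ _ q s β

overline-· : (δ : Tm Γ (J R X)) (p : Tm Γ (X ⇒ R)) →
             HAω[ Ax ] Δ ⊢ overline δ · p ≐ p · (δ · p)
overline-· δ p = β₂ _ δ p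

shift-nil : (q : Tm Γ (X ω ⇒ R)) → HAω[ Ax ] Δ ⊢ shift q nil ≐ q
shift-nil q = ≐-ext (∀I (≐-trans (shift-· _ _ _) (ap _ (nil-⊛ _))))

-- The equation of `eps` shifts by one entry at a time, p_n by a whole segment. The two agree
-- extensionally, since `snoc-⊛` moves the last entry to the head of the tail.
shift-shift : (q : Tm Γ (X ω ⇒ R)) (s : Tm Γ (X *)) (x : Tm Γ X) →
              HAω[ Ax ] Δ ⊢ shift (shift q s) ⟨ x ⟩ ≐ shift q (snoc s x)
shift-shift q s x = ≐-ext (∀I
  (≐-trans (shift-· _ _ _) (≐-trans (shift-· _ _ _)
  (≐-trans (ap _ (⊛-cong (≐-refl _) (⟨⟩-⊛ _ _)))
  (≐-sym (≐-trans (shift-· _ _ _) (ap _ (snoc-⊛ _ _ _))))))))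

initial-⊛-+ : (α : Tm Γ (X ω)) (n : Tm Γ nat) (β : Tm Γ (X ω)) (j : Tm Γ nat) →
              HAω[ Ax ] Δ ⊢ (initial α n ⊛ β) · (n +̇ j) ≐ β · j
initial-⊛-+ {X = X} α n β j = instantiate {Θ = nat ∷ X ω ∷ nat ∷ X ω ∷ []}
  {φ = (initial v3 v2 ⊛ v1) · (v2 +̇ v0) ≐ v1 · v0}
  -- The tail and the offset stay quantified: from `n` to `sucᵗ n` the last entry of the segment
  -- moves to the head of the tail and the offset grows by one.
  (∀I (ind-nat (∀̇ (X ω) (∀̇ nat ((initial v3 v2 ⊛ v1) · (v2 +̇ v0) ≐ v1 · v0)))
    (∀I (∀I (≐-trans (⊛-cong (initial-zero _) (≐-refl _)) (nil-⊛ _) ⟨·⟩ zero-+ _)))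
    (∀I (⇒I (∀I (∀I
      ((initial v3 (sucᵗ v2) ⊛ v1) · (sucᵗ v2 +̇ v0)
         ≐⟨ ≐-trans (⊛-cong (initial-suc _ _) (≐-refl _)) (snoc-⊛ _ _ _)
            ⟨·⟩ ≐-trans (suc-+ _ _) (≐-sym (+-suc _ _)) ⟩
       (initial v3 v2 ⊛ consω (v3 · v2) v1) · (v2 +̇ sucᵗ v0)
         ≐⟨ ∀E (∀E (hyp (here refl)) (consω (v3 · v2) v1)) (sucᵗ v0) ⟩
       consω (v3 · v2) v1 · sucᵗ v0
         ≐⟨ consω-suc _ _ _ ⟩
       v1 · v0 ∎)))))))
  (j ∷ β ∷ n ∷ α ∷ [])

·-of-initial-⊛ : {α γ : Tm Γ (X ω)} {n : Tm Γ nat} →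
                 HAω[ Ax ] Δ ⊢ α ≐ initial α n ⊛ γ → HAω[ Ax ] Δ ⊢ α · n ≐ γ · zeroᵗ
·-of-initial-⊛ {α = α} {γ} {n} d =
  ≐-trans (d ⟨·⟩ ≐-sym (+-zero n)) (initial-⊛-+ α n γ zeroᵗ)

-- The functional eps

-- The entry `c` in the equation of `eps`. At `shift q (initial α n)` it is ε_n(p_n) up to merging
-- two shifts.
choice : Tm Γ (R ⇒ nat) → Tm Γ nat → Tm Γ (nat ⇒ J R X) → Tm Γ (X ω ⇒ R) → Tm Γ X
choice ℓ n ε q =
  ε · n · lam (overline (eps (wk ℓ) (sucᵗ (wk n)) (wk ε)) · shift (wk q) ⟨ v0 ⟩)

eps-equation-at : (ℓ : Tm Γ (R ⇒ nat)) (n : Tm Γ nat) (ε : Tm Γ (nat ⇒ J R X))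
  (q : Tm Γ (X ω ⇒ R)) → let c = choice ℓ n ε q in
  HAω[ EpsAxiom ] Δ ⊢
    (ℓ · (q · 𝟎 (X ω)) <̇ n ⇒̇ eps ℓ n ε · q ≐ 𝟎 (X ω)) ∧̇
    (¬̇ (ℓ · (q · 𝟎 (X ω)) <̇ n) ⇒̇
       eps ℓ n ε · q ≐ ⟨ c ⟩ ⊛ (eps ℓ (sucᵗ n) ε · shift q ⟨ c ⟩))
eps-equation-at {R = R} {X = X} {Δ = Δ} ℓ n ε q =
  -- The instance of the axiom computes except at the zero sequences, which are corrected here.
  -- `_<̇_` is unfolded because `z` stands under its existential quantifier.
  subst₂ (λ z z′ → let c = choice ℓ n ε q in HAω[ EpsAxiom ] Δ ⊢
      (∃̇ nat (sucᵗ (wk ℓ · (wk q · z)) +̇ v0 ≐ wk n) ⇒̇ eps ℓ n ε · q ≐ z′) ∧̇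
      (¬̇ (∃̇ nat (sucᵗ (wk ℓ · (wk q · z)) +̇ v0 ≐ wk n)) ⇒̇
         eps ℓ n ε · q ≐ ⟨ c ⟩ ⊛ (eps ℓ (sucᵗ n) ε · shift q ⟨ c ⟩)))
    (trans (cong (sub _) (trans (cong (ren _) (ren-𝟎 there (X ω))) (ren-𝟎 _ (X ω))))
      (trans (sub-𝟎 _ (X ω)) (sym (ren-𝟎 there (X ω)))))
    (trans (cong (sub _) (ren-𝟎 _ (X ω))) (sub-𝟎 _ (X ω)))
    (instantiate {Θ = (X ω ⇒ R) ∷ (nat ⇒ J R X) ∷ nat ∷ (R ⇒ nat) ∷ []}
       (axiom (eps-eq X R)) (q ∷ ε ∷ n ∷ ℓ ∷ []))

⊛-eps-cong : {ℓ : Tm Γ (R ⇒ nat)} {n : Tm Γ nat} {ε : Tm Γ (nat ⇒ J R X)}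
             {q : Tm Γ (X ω ⇒ R)} {s t : Tm Γ (X *)} →
             HAω[ Ax ] Δ ⊢ s ≐ t →
             HAω[ Ax ] Δ ⊢ s ⊛ (eps ℓ n ε · shift q s) ≐ t ⊛ (eps ℓ n ε · shift q t)
⊛-eps-cong d = ⊛-cong d (ap _ (ap _ d))

-- `α` is an arbitrary sequence here; its origin in `eps` enters only through `invariant n`.
module Invariant (ℓ : Tm Γ (R ⇒ nat)) (ε : Tm Γ (nat ⇒ J R X))
  (q : Tm Γ (X ω ⇒ R)) (α : Tm Γ (X ω)) where

  -- `stop n` is the premise of the first clause for `eps ℓ n ε` at `shift q (initial α n)`.
  -- `continue n` expresses its negation positively, so that the two are the alternatives of
  -- `<-or-≥`.
  invariant stop continue : Tm Γ nat → Fm Γ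
  invariant n = α ≐ initial α n ⊛ (eps ℓ n ε · shift q (initial α n))
  stop n      = ℓ · (shift q (initial α n) · 𝟎 (X ω)) <̇ n
  continue n  = n ≤̇ ℓ · (shift q (initial α n) · 𝟎 (X ω))

  stop-or-continue : (n : Tm Γ nat) → HAω[ EpsAxiom ] Δ ⊢ stop n ∨̇ continue n
  stop-or-continue n = <-or-≥ _ n

  module _ (n : Tm Γ nat) {Δ : List (Fm Γ)}
    (inv : HAω[ EpsAxiom ] Δ ⊢ invariant n) where

    private
      s s′ : Tm Γ (X *)
      s  = initial α n
      s′ = initial α (sucᵗ n)

      c : Tm Γ X
      c = choice ℓ n ε (shift q s)

    module _ (h : HAω[ EpsAxiom ] Δ ⊢ stop n) where

      α-stop : HAω[ EpsAxiom ] Δ ⊢ α ≐ s ⊛ 𝟎 (X ω)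
      α-stop = ≐-trans inv (⊛-cong (≐-refl _) (⇒E (∧E₁ (eps-equation-at _ _ _ _)) h))

      qα-stop : HAω[ EpsAxiom ] Δ ⊢ q · α ≐ shift q s · 𝟎 (X ω)
      qα-stop = ≐-trans (ap q α-stop) (≐-sym (shift-· _ _ _))

      -- The first zero of the tail moves into the segment. It is the true entry of `α` there, since
      -- `α-stop` gives `α · n ≐ 𝟎 X`.
      α-stop-suc : HAω[ EpsAxiom ] Δ ⊢ α ≐ s′ ⊛ 𝟎 (X ω)
      α-stop-suc =
        α                          ≐⟨ α-stop ⟩
        s ⊛ 𝟎 (X ω)                ≐⟨ ⊛-cong (≐-refl s) (consω-𝟎 X) ⟨
        s ⊛ consω (𝟎 X) (𝟎 (X ω))  ≐⟨ snoc-⊛ _ _ _ ⟨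
        snoc s (𝟎 X) ⊛ 𝟎 (X ω)     ≐⟨ ⊛-cong (ap _ (≐-trans (·-of-initial-⊛ α-stop)
                                                            (𝟎ω-· zeroᵗ))) (≐-refl _) ⟨
        snoc s (α · n) ⊛ 𝟎 (X ω)   ≐⟨ ⊛-cong (initial-suc α n) (≐-refl _) ⟨
        s′ ⊛ 𝟎 (X ω)               ∎

      -- Both shifted functionals take the value `q · α` at the zero sequence, so `ℓ` gives the same
      -- number, and the strict bound `n` may be raised to `sucᵗ n`.
      stop-suc : HAω[ EpsAxiom ] Δ ⊢ stop (sucᵗ n)
      stop-suc = ⇒E (<-suc _ _) (⇒E (⇒E (<-resp-≐ _ _ _) (ap ℓ
        (shift q s · 𝟎 (X ω)    ≐⟨ qα-stop ⟨
         q · α                  ≐⟨ ap q α-stop-suc ⟩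
         q · (s′ ⊛ 𝟎 (X ω))     ≐⟨ shift-· _ _ _ ⟨
         shift q s′ · 𝟎 (X ω)   ∎))) h)

      step-stop : HAω[ EpsAxiom ] Δ ⊢ invariant (sucᵗ n)
      step-stop = ≐-trans α-stop-suc
        (⊛-cong (≐-refl s′) (≐-sym (⇒E (∧E₁ (eps-equation-at _ _ _ _)) stop-suc)))

    module _ (h : HAω[ EpsAxiom ] Δ ⊢ continue n) where

      α-continue : HAω[ EpsAxiom ] Δ ⊢
                     α ≐ s ⊛ consω c (eps ℓ (sucᵗ n) ε · shift q (snoc s c))
      α-continue = ≐-trans inv (⊛-cong (≐-refl _)
        (eps ℓ n ε · shift q s
           ≐⟨ ⇒E (∧E₂ (eps-equation-at _ _ _ _)) (⇒E (≤⇒≯ _ _) h) ⟩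
         ⟨ c ⟩ ⊛ (eps ℓ (sucᵗ n) ε · shift (shift q s) ⟨ c ⟩)
           ≐⟨ ⟨⟩-⊛ _ _ ⟩
         consω c (eps ℓ (sucᵗ n) ε · shift (shift q s) ⟨ c ⟩)
           ≐⟨ ap _ (ap _ (shift-shift q s c)) ⟩
         consω c (eps ℓ (sucᵗ n) ε · shift q (snoc s c)) ∎))

      head-continue : HAω[ EpsAxiom ] Δ ⊢ α · n ≐ c
      head-continue = ≐-trans (·-of-initial-⊛ α-continue) (consω-zero _ _)

      step-continue : HAω[ EpsAxiom ] Δ ⊢ invariant (sucᵗ n)
      step-continue =
        α                                                    ≐⟨ α-continue ⟩
        s ⊛ consω c (eps ℓ (sucᵗ n) ε · shift q (snoc s c))  ≐⟨ snoc-⊛ _ _ _ ⟨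
        -- `s′` is `snoc s (α · n)`, and `head-continue` identifies `α · n` with `c`. The segment is
        -- replaced both in front of the tail and inside it.
        snoc s c ⊛ (eps ℓ (sucᵗ n) ε · shift q (snoc s c))   ≐⟨ ⊛-eps-cong
          (≐-trans (initial-suc α n) (ap _ head-continue)) ⟨
        s′ ⊛ (eps ℓ (sucᵗ n) ε · shift q s′)                 ∎

eps-invariant : (ℓ : Tm Γ (R ⇒ nat)) (ε : Tm Γ (nat ⇒ J R X)) (q : Tm Γ (X ω ⇒ R))
                (n : Tm Γ nat) → let α = eps ℓ zeroᵗ ε · q in
                HAω[ EpsAxiom ] Δ ⊢ Invariant.invariant ℓ ε q α n
eps-invariant {R = R} {X = X} ℓ ε q n =
  instantiate {Θ = nat ∷ (X ω ⇒ R) ∷ (nat ⇒ J R X) ∷ (R ⇒ nat) ∷ []} {φ = invariant v0}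
    (∀I (∀I (∀I (ind-nat (invariant v0)
      -- At zero the segment is empty and the right-hand side becomes eps_0(q), which is how `α` is
      -- defined.
      (≐-sym (≐-trans (⊛-eps-cong (initial-zero _)) (≐-trans (nil-⊛ _) (ap _ (shift-nil _)))))
      (∀I (⇒I (∨E (stop-or-continue v0)
        (step-stop v0 (hyp (there (here refl))) (hyp (here refl)))
        (step-continue v0 (hyp (there (here refl))) (hyp (here refl))))))))))
    (n ∷ q ∷ ε ∷ ℓ ∷ [])
  where open Invariant v3 v2 v1 (eps v3 zeroᵗ v2 · v1)

theorem3p8 : (X R : Ty) →
    HAω+eps⊢
      ∀̇ (X ω ⇒ R) (∀̇ (R ⇒ nat) (∀̇ (nat ⇒ J R X) (∀̇ nat
        (let q = v3
             ℓ = v2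
             ε = v1
             n = v0
             α = eps ℓ zeroᵗ ε · q
             p = lam (overline (eps (wk ℓ) (sucᵗ (wk n)) (wk ε))
                        · shift (wk q) (snoc (initial (wk α) (wk n)) v0))
         in
         n ≤̇ ℓ · (q · α)
           ⇒̇ (α · n ≐ ε · n · p) ∧̇ (p · (α · n) ≐ q · α)))))
theorem3p8 X R = ∀I (∀I (∀I (∀I (⇒I (∧I
  (∨E (stop-or-continue n)
    -- Under `stop n` the value `q · α` is that of `shift q (initial α n)` at zero, so ℓ(q(α)) < n,
    -- against the assumption.
    (⊥E (⇒E (⇒E (≤⇒≯ _ _) (hyp (there (here refl))))
      (⇒E (⇒E (<-resp-≐ _ _ _) (ap ℓ (≐-sym (qα-stop n inv (hyp (here refl))))))
        (hyp (here refl)))))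
    (≐-trans (head-continue n inv (hyp (here refl)))
      -- `choice` has two nested shifts under its abstraction, p_n a single one; `ξ` merges them.
      (ap _ (ξ (ap _ (shift-shift _ _ _))))))
  -- Unfolding turns `p · (α · n)` into `q` applied to `snoc (initial α n) (α · n)` followed by its
  -- `eps` tail. By the invariant at `sucᵗ n` this sequence is `α`.
  (≐-trans (β-lam _ _) (≐-trans (overline-· _ _) (≐-trans (shift-· _ _ _)
    (ap q (≐-sym (≐-trans (eps-invariant ℓ ε q (sucᵗ n))
                          (⊛-eps-cong (initial-suc α n)))))))))))))
  where
  Γ₀ : Ctx
  Γ₀ = nat ∷ (nat ⇒ J R X) ∷ (R ⇒ nat) ∷ (X ω ⇒ R) ∷ []

  q : Tm Γ₀ (X ω ⇒ R)
  q = v3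
  ℓ : Tm Γ₀ (R ⇒ nat)
  ℓ = v2
  ε : Tm Γ₀ (nat ⇒ J R X)
  ε = v1
  n : Tm Γ₀ nat
  n = v0
  α : Tm Γ₀ (X ω)
  α = eps ℓ zeroᵗ ε · q

  open Invariant ℓ ε q α

  inv : HAω[ EpsAxiom ] Δ ⊢ invariant n
  inv = eps-invariant ℓ ε q n
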